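{- For every positive integer $d$, $f(d) \leq 1.373\, d^2 + 6.971\, d - 1$. That is, every $2$-edge connected graph of diameter $d$ has a strong orientation whose diameter is at most $1.373\, d^2 + 6.971\, d - 1$.
   Context: An orientation of an undirected graph $G$ assigns exactly one direction to each edge. The diameter of a directed graph is the maximum, over ordered pairs of vertices $(u,v)$, of the length of a shortest directed path from $u$ to $v$. The oriented diameter $\vec{d}(G)$ of $G$ is the minimum diameter over all orientations of $G$. $f(d)$ denotes the maximum of $\vec{d}(G)$ over all $2$-edge connected (connected and bridgeless) graphs $G$ of diameter $d$. -}

module Defs where

open import Data.Nat using (ℕ; zero; suc; _+_; _*_; _≤_; _<_)
open import Data.Fin using (Fin)
open import Data.Bool using (Bool; true; false)
open import Data.Product using (Σ; ∃; _×_; _,_)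
open import Data.Sum using (_⊎_)
open import Relation.Nullary using (¬_)
open import Relation.Binary.PropositionalEquality using (_≡_)

record Graph (n : ℕ) : Set where
  field
    adj   : Fin n → Fin n → Bool
    sym   : ∀ u v → adj u v ≡ adj v u
    irrefl : ∀ u → adj u u ≡ false

open Graph public

Edge : ∀ {n} → Graph n → Fin n → Fin n → Set
Edge G u v = adj G u v ≡ true

data Walk {n : ℕ} (R : Fin n → Fin n → Set) : Fin n → Fin n → ℕ → Set where
  here : ∀ {u} → Walk R u u zero
  step : ∀ {u w v k} → R u w → Walk R w v k → Walk R u v (suc k)

DistLe : ∀ {n} → (Fin n → Fin n → Set) → Fin n → Fin n → ℕ → Set
DistLe R u v D = Σ ℕ λ k → k ≤ D × Walk R u v k

DistEq : ∀ {n} → (Fin n → Fin n → Set) → Fin n → Fin n → ℕ → Set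
DistEq R u v D = Walk R u v D × (∀ k → k < D → ¬ Walk R u v k)

DiamLe : ∀ {n} → (Fin n → Fin n → Set) → ℕ → Set
DiamLe {n} R D = ∀ (u v : Fin n) → DistLe R u v D

HasDiameter : ∀ {n} → (Fin n → Fin n → Set) → ℕ → Set
HasDiameter {n} R D = DiamLe R D × Σ (Fin n) λ u → Σ (Fin n) λ v → DistEq R u v D

Connected : ∀ {n} → (Fin n → Fin n → Set) → Set
Connected {n} R = ∀ (u v : Fin n) → Σ ℕ λ k → Walk R u v k

EdgeMinus : ∀ {n} → Graph n → Fin n → Fin n → Fin n → Fin n → Set
EdgeMinus G a b x y = Edge G x y × ¬ (x ≡ a × y ≡ b) × ¬ (x ≡ b × y ≡ a)

TwoEdgeConnected : ∀ {n} → Graph n → Set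
TwoEdgeConnected G = Connected (Edge G)
  × (∀ a b → Edge G a b → Connected (EdgeMinus G a b))

record Orientation {n : ℕ} (G : Graph n) : Set where
  field
    arc     : Fin n → Fin n → Bool
    arc⊆edge : ∀ u v → arc u v ≡ true → Edge G u v
    oneDir  : ∀ u v → Edge G u v →
              (arc u v ≡ true × arc v u ≡ false) ⊎ (arc v u ≡ true × arc u v ≡ false)

open Orientation public

Arc : ∀ {n} {G : Graph n} → Orientation G → Fin n → Fin n → Set
Arc O u v = arc O u v ≡ true

{-# OPTIONS --safe #-}
module Submission where

-- Contract an oriented subgraph S of which every vertex is within distance r, and let 2r and k bound the
-- detours avoiding an edge. The BFS branches hanging from S, joined whenever an edge between them closes a
-- cycle of length at most 1 + min(2r, k) through S, form a graph in which every branch has a neighbour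
-- (or closes such a cycle alone). Two-colour it so that every branch has a neighbour of the other colour,
-- and orient the branches of one colour away from S and the others towards S: every neighbour of S then lies
-- on a short directed cycle through S. Absorb these cycles into S and repeat with r − 1.
--
-- If every edge lies in a cycle of length at most 4t + 1, where t ≈ 0.1715 d, start from a single vertex and
-- pay 4t per round. Otherwise take an edge pq in no such cycle. Split the vertices by whether p or q is closer,
-- direct pq from q to p, direct the other edges away from p on the side of p, towards q on the side of q, and
-- from the former to the latter in between. The directed cycles of length at most 2d + 1 through p then form a
-- core that contains all edges between the sides and is within d − 1 − t of every vertex; pay 2r in round r.

open import Defs
open import Data.Bool using (Bool; true; false; not; if_then_else_; _∧_)
open import Data.Bool.Properties using (not-involutive) renaming (_≟_ to _≟ᵇ_)
open import Data.Fin using (Fin)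
open import Data.Fin.Properties using (any?) renaming (_≟_ to _≟ᶠ_; <-cmp to <ᶠ-cmp)
open import Data.List using (List; []; _∷_; allFin)
open import Data.List.Membership.Propositional using (_∈_)
open import Data.List.Membership.Propositional.Properties using (∈-allFin)
open import Data.List.Relation.Unary.Any using () renaming (here to first; there to later)
open import Data.Maybe using (Maybe; just; nothing; fromMaybe)
open import Data.Nat using (ℕ; NonZero; zero; suc; _+_; _*_; _∸_; _⊓_; _≤_; _<_; z≤n; s≤s; _≤?_)
open import Data.Nat.DivMod using (_/_; m/n*n≤m; m≡m%n+[m/n]*n; m%n<n)
open import Data.Nat.Properties
open import Data.Nat.Solver using (module +-*-Solver)
open import Data.Product using (Σ; ∃-syntax; _×_; _,_; proj₁; proj₂)
open import Data.Sum using (_⊎_; inj₁; inj₂)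
open import Data.Unit using (tt)
open import Data.Vec.Functional using (updateAt)
open import Data.Vec.Functional.Properties using (updateAt-updates; updateAt-minimal)
open import Function using (const; _∘_)
open import Relation.Binary.Definitions using (Symmetric; tri<; tri≈; tri>)
open import Relation.Binary.PropositionalEquality using (_≡_; _≢_; refl; trans; cong; cong₂; subst; subst₂) renaming (sym to ≡-sym)
open import Relation.Nullary using (¬_; Dec; yes; no; does; ¬?; contradiction; _×-dec_; _⊎-dec_)
open import Relation.Nullary.Decidable using (map′; decidable-stable)
open +-*-Solver using (solve; _:+_; _:*_; _:=_; con)

-- Walks and decidable reachability.

Rel₀ Pred₀ : ℕ → Set₁
Rel₀ n = Fin n → Fin n → Set
Pred₀ n = Fin n → Set

Dec₁ : ∀ {n} → Pred₀ n → Set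
Dec₁ P = ∀ v → Dec (P v)

Dec₂ : ∀ {n} → Rel₀ n → Set
Dec₂ R = ∀ u v → Dec (R u v)

private
  variable
    n k l : ℕ
    u v w : Fin n
    R Q : Rel₀ n
    P S : Pred₀ n

mapʷ : (∀ {x y} → R x y → Q x y) → Walk R u v k → Walk Q u v k
mapʷ f here = here
mapʷ f (step r ω) = step (f r) (mapʷ f ω)

infixr 5 _++ʷ_
infixl 6 _∷ʳʷ_

_++ʷ_ : Walk R u v k → Walk R v w l → Walk R u w (k + l)
here ++ʷ η = η
step r ω ++ʷ η = step r (ω ++ʷ η)

_∷ʳʷ_ : Walk R u v k → R v w → Walk R u w (suc k)
here ∷ʳʷ r = step r here
step r′ ω ∷ʳʷ r = step r′ (ω ∷ʳʷ r)

walk? : Dec₂ R → ∀ k (u v : Fin n) → Dec (Walk R u v k)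
walk? R? zero u v with u ≟ᶠ v
... | yes refl = yes here
... | no u≢v = no λ { here → u≢v refl }
walk? R? (suc k) u v = map′ (λ { (_ , r , ω) → step r ω }) (λ { (step r ω) → _ , r , ω })
  (any? λ w → R? u w ×-dec walk? R? k w v)

exit : Dec₁ P → Walk R u v k → P u → ¬ P v →
  ∃[ x ] ∃[ y ] ∃[ i ] ∃[ j ] (Walk R u x i × R x y × Walk R y v j × P x × ¬ P y × i + suc j ≡ k)
exit P? here Pu ¬Pv = contradiction Pu ¬Pv
exit P? (step {w = w} r ω) Pu ¬Pv with P? w
... | no ¬Pw = _ , _ , 0 , _ , here , r , ω , Pu , ¬Pw , refl
... | yes Pw with exit P? ω Pw ¬Pv
...   | x , y , i , j , α , s , ζ , Px , ¬Py , eq =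
        x , y , suc i , j , step r α , s , ζ , Px , ¬Py , cong suc eq

Reach Reached : Rel₀ n → Pred₀ n → Fin n → ℕ → Set
Reach R S v k = ∃[ s ] (S s × Walk R v s k)
Reached R S v k = ∃[ s ] (S s × Walk R s v k)

reach? : Dec₂ R → Dec₁ S → ∀ v k → Dec (Reach R S v k)
reach? R? S? v k = any? λ s → S? s ×-dec walk? R? k v s

reached? : Dec₂ R → Dec₁ S → ∀ v k → Dec (Reached R S v k)
reached? R? S? v k = any? λ s → S? s ×-dec walk? R? k s v

minimum : {P : ℕ → Set} → (∀ k → Dec (P k)) → ∀ k → P k → ∃[ m ] (P m × (∀ {j} → P j → m ≤ j))
minimum P? zero p = 0 , p , λ _ → z≤n
minimum P? (suc k) p with P? 0
... | yes p₀ = 0 , p₀ , λ _ → z≤n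
... | no ¬p₀ with minimum (P? ∘ suc) k p
...   | m , pₘ , min = suc m , pₘ , λ { {zero} p₀ → contradiction p₀ ¬p₀ ; {suc j} pⱼ → s≤s (min pⱼ) }

-- Distance levels of a vertex set.

edge? : (G : Graph n) → Dec₂ (Edge G)
edge? G u v = adj G u v ≟ᵇ true

edge-sym : (G : Graph n) → Edge G u v → Edge G v u
edge-sym G e = trans (sym G _ _) e

edge-≢ : (G : Graph n) → Edge G u v → u ≢ v
edge-≢ G e refl with trans (≡-sym e) (irrefl G _)
... | ()

edgeMinus? : (G : Graph n) → ∀ a b → Dec₂ (EdgeMinus G a b)
edgeMinus? G a b x y = edge? G x y ×-dec
  (¬? ((x ≟ᶠ a) ×-dec (y ≟ᶠ b)) ×-dec ¬? ((x ≟ᶠ b) ×-dec (y ≟ᶠ a)))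

next : Reach {n} R S v k → Fin n
next (s , _ , here) = s
next (_ , _ , step {w = w} _ _) = w

next-step : (ρ : Reach R S v k) → k ≡ suc l → R v (next ρ) × Reach R S (next ρ) l
next-step (_ , Ss , step r ω) refl = r , _ , Ss , ω

reverse : (G : Graph n) → Walk (Edge G) u v k → Walk (Edge G) v u k
reverse G here = here
reverse G (step e ω) = reverse G ω ∷ʳʷ edge-sym G e

record Levels (G : Graph n) (S : Pred₀ n) : Set where
  field
    δ     : Fin n → ℕ
    reach : ∀ v → Reach (Edge G) S v (δ v)
    least : Reach (Edge G) S v k → δ v ≤ k

  S⇒0 : S v → δ v ≡ 0
  S⇒0 Sv = n≤0⇒n≡0 (least (_ , Sv , here))

  0⇒S : δ v ≡ 0 → S v
  0⇒S {v} eq with subst (Reach (Edge G) S v) eq (reach v)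
  ... | _ , Sv , here = Sv

  δ-suc : ¬ S v → ∃[ j ] (δ v ≡ suc j)
  δ-suc {v} ¬Sv with δ v in eq
  ... | zero = contradiction (0⇒S eq) ¬Sv
  ... | suc j = j , refl

  suc⇒¬S : δ v ≡ suc k → ¬ S v
  suc⇒¬S eq Sv with trans (≡-sym eq) (S⇒0 Sv)
  ... | ()

  δ-walk : Walk (Edge G) u v k → δ u ≤ k + δ v
  δ-walk {v = v} ω with reach v
  ... | s , Ss , η = least (s , Ss , ω ++ʷ η)

  δ-edge : Edge G u v → δ u ≤ suc (δ v)
  δ-edge e = δ-walk (step e here)

  parent : Fin n → Fin n
  parent v = next (reach v)

  parent-edge : δ v ≡ suc k → Edge G v (parent v)
  parent-edge {v} eq = proj₁ (next-step (reach v) eq)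

  δ-parent : δ v ≡ suc k → δ (parent v) ≡ k
  δ-parent {v} eq = ≤-antisym (least (proj₂ (next-step (reach v) eq)))
    (≤-pred (subst (_≤ suc (δ (parent v))) eq (δ-edge (parent-edge eq))))

levels : (G : Graph n) → Dec₁ S → (∀ v → ∃[ k ] Reach (Edge G) S v k) → Levels G S
levels {S = S} G S? near = record
  { δ = λ v → proj₁ (m v)
  ; reach = λ v → proj₁ (proj₂ (m v))
  ; least = λ {v} → proj₂ (proj₂ (m v)) }
  where
  m : ∀ v → ∃[ k ] (Reach (Edge G) S v k × (∀ {j} → Reach (Edge G) S v j → k ≤ j))
  m v = minimum (reach? (edge? G) S? v) (proj₁ (near v)) (proj₂ (near v))

-- Orientations induced by keys.

Antisymmetric : (Fin n → Fin n → Bool) → Set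
Antisymmetric o = ∀ u v → u ≢ v → o u v ≡ not (o v u)

-- The edge uv points to the endpoint with the larger key; the key of u may depend on v.
abstract
  byKey : (Fin n → Fin n → ℕ) → Fin n → Fin n → Bool
  byKey f u v with <-cmp (f u v) (f v u)
  ... | tri< _ _ _ = true
  ... | tri> _ _ _ = false
  ... | tri≈ _ _ _ with <ᶠ-cmp u v
  ...   | tri< _ _ _ = true
  ...   | _ = false

  byKey-antisym : (f : Fin n → Fin n → ℕ) → Antisymmetric (byKey f)
  byKey-antisym f u v u≢v with <-cmp (f u v) (f v u) | <-cmp (f v u) (f u v)
  ... | tri< a _ _ | tri< b _ _ = contradiction b (<-asym a)
  ... | tri< a _ _ | tri≈ _ b _ = contradiction (≡-sym b) (<⇒≢ a)
  ... | tri< _ _ _ | tri> _ _ _ = refl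
  ... | tri> _ _ _ | tri< _ _ _ = refl
  ... | tri> _ _ a | tri≈ _ b _ = contradiction b (<⇒≢ a)
  ... | tri> _ _ a | tri> _ _ b = contradiction b (<-asym a)
  ... | tri≈ _ a _ | tri< b _ _ = contradiction (≡-sym a) (<⇒≢ b)
  ... | tri≈ _ a _ | tri> _ _ b = contradiction a (<⇒≢ b)
  ... | tri≈ _ _ _ | tri≈ _ _ _ with <ᶠ-cmp u v | <ᶠ-cmp v u
  ...   | tri< a ¬b ¬c | tri< a' _ _ = contradiction a' ¬c
  ...   | tri< _ _ _ | tri≈ _ b _ = contradiction (≡-sym b) u≢v
  ...   | tri< _ _ _ | tri> _ _ _ = refl
  ...   | tri≈ _ b _ | _ = contradiction b u≢v
  ...   | tri> _ _ _ | tri< _ _ _ = refl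
  ...   | tri> _ _ _ | tri≈ _ b _ = contradiction (≡-sym b) u≢v
  ...   | tri> ¬a _ _ | tri> _ _ c = contradiction c ¬a

  byKey-true : (f : Fin n → Fin n → ℕ) → f u v < f v u → byKey f u v ≡ true
  byKey-true {u = u} {v} f lt with <-cmp (f u v) (f v u)
  ... | tri< _ _ _ = refl
  ... | tri≈ ¬lt _ _ = contradiction lt ¬lt
  ... | tri> ¬lt _ _ = contradiction lt ¬lt

-- Contracting a set and absorbing the short cycles through it.

OutArc : Graph n → Pred₀ n → (Fin n → Fin n → Bool) → Rel₀ n
OutArc G S o u v = Edge G u v × o u v ≡ true × ¬ (S u × S v)

outArc? : (G : Graph n) → Dec₁ S → ∀ o → Dec₂ (OutArc G S o)
outArc? G S? o u v = edge? G u v ×-dec ((o u v ≟ᵇ true) ×-dec ¬? (S? u ×-dec S? v))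

Linked : Rel₀ n → Pred₀ n → ℕ → Fin n → Set
Linked R S ρ v = (∃[ k ] (k ≤ ρ × Reached R S v k)) × (∃[ k ] (k ≤ ρ × Reach R S v k))

-- S can be contracted: the arcs inside S are left free.
Span : Graph n → Pred₀ n → ℕ → Set
Span {n} G S ρ = Σ (Fin n → Fin n → Bool) λ o → Antisymmetric o × (∀ v → Linked (OutArc G S o) S ρ v)

module Closure {n} {R : Rel₀ n} (R? : Dec₂ R) {S : Pred₀ n} (S? : Dec₁ S) (β : ℕ) where

  -- A short closed walk after contraction of `S`: its two ends may be different vertices of `S`.
  -- The separate bounds on `a` and `b` make the search finite.
  Loop : Pred₀ n
  Loop v = ∃[ a ] (a < 2 + β × ∃[ b ] (b < 2 + β × (a + b ≤ 1 + β × Reached R S v a × Reach R S v b)))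

  Core : Pred₀ n
  Core v = S v ⊎ Loop v

  abstract
    core? : Dec₁ Core
    core? v = S? v ⊎-dec anyUpTo? (λ a → anyUpTo? (λ b →
      (a + b ≤? 1 + β) ×-dec (reached? R? S? v a ×-dec reach? R? S? v b)) (2 + β)) (2 + β)

  loop : Reached R S v k → Reach R S v l → k + l ≤ 1 + β → Core v
  loop {k = a} {l = b} from to a+b≤ =
    inj₂ (a , s≤s (≤-trans (m≤m+n a b) a+b≤) , b , s≤s (≤-trans (m≤n+m b a) a+b≤) , a+b≤ , from , to)

  Inner : Rel₀ n
  Inner u v = R u v × Core u × Core v

  -- Each vertex of a short walk from `S` to `S` cuts it into two parts that witness its own
  -- membership in `Core`. The induction shifts the steps one by one into the prefix.
  inner : ∀ {i b} → Reached R S u i → Walk R u v k → Reach R S v b → i + k + b ≤ 1 + β → Walk Inner u v k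
  inner from here to _ = here
  inner {i = i} {b} (s , Ss , α) (step {w = w} {k = j} r ω) (s′ , Ss′ , ζ) bound =
    step (r , loop (s , Ss , α) (s′ , Ss′ , step r ω ++ʷ ζ) bound₀
            , loop (s , Ss , α ∷ʳʷ r) (s′ , Ss′ , ω ++ʷ ζ) bound₁)
         (inner (s , Ss , α ∷ʳʷ r) ω (s′ , Ss′ , ζ) bound₂)
    where
    bound₀ : i + (suc j + b) ≤ 1 + β
    bound₀ = subst (_≤ 1 + β) (+-assoc i (suc j) b) bound
    bound₁ : suc i + (j + b) ≤ 1 + β
    bound₁ = subst (_≤ 1 + β) (+-suc i (j + b)) bound₀
    bound₂ : suc i + j + b ≤ 1 + β
    bound₂ = subst (λ m → m + b ≤ 1 + β) (+-suc i j) bound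

  linked : Core v → Linked Inner S β v
  linked {v} core with S? v
  ... | yes Sv = (0 , z≤n , v , Sv , here) , (0 , z≤n , v , Sv , here)
  linked (inj₁ Sv) | no ¬Sv = contradiction Sv ¬Sv
  linked (inj₂ (zero , _ , _ , _ , _ , (_ , Ss , here) , _)) | no ¬Sv = contradiction Ss ¬Sv
  linked (inj₂ (suc _ , _ , zero , _ , _ , _ , (_ , Ss , here))) | no ¬Sv = contradiction Ss ¬Sv
  -- Outside `S` both parts of the cycle have at least one step, so each has at most `β` of the
  -- `1 + β` steps.
  linked (inj₂ (suc a , _ , suc b , _ , a+b≤ , (s , Ss , α) , (s′ , Ss′ , ζ))) | no _ =
    (suc a , ≤-trans (≤-trans (m≤m+n (suc a) b) (≤-reflexive (≡-sym (+-suc a b)))) (≤-pred a+b≤)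
       , s , Ss , inner (s , Ss , here) α (s′ , Ss′ , ζ) a+b≤) ,
    (suc b , ≤-trans (m≤n+m (suc b) a) (≤-pred a+b≤)
       , s′ , Ss′ , inner (s , Ss , α) ζ (s′ , Ss′ , here) (subst (_≤ 1 + β) (≡-sym (+-identityʳ _)) a+b≤))

module Splice {n} {C : Pred₀ n} (C? : Dec₁ C) (o o′ : Fin n → Fin n → Bool) where

  splice : Fin n → Fin n → Bool
  splice u v = if does (C? u) ∧ does (C? v) then o u v else o′ u v

  splice-antisym : Antisymmetric o → Antisymmetric o′ → Antisymmetric splice
  splice-antisym o-anti o′-anti u v u≢v with C? u | C? v
  ... | yes _ | yes _ = o-anti u v u≢v
  ... | yes _ | no _ = o′-anti u v u≢v
  ... | no _ | yes _ = o′-anti u v u≢v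
  ... | no _ | no _ = o′-anti u v u≢v

  splice-inside : C u → C v → splice u v ≡ o u v
  splice-inside {u} {v} cu cv with C? u | C? v
  ... | yes _ | yes _ = refl
  ... | yes _ | no ¬cv = contradiction cv ¬cv
  ... | no ¬cu | _ = contradiction cu ¬cu

  splice-outside : ¬ (C u × C v) → splice u v ≡ o′ u v
  splice-outside {u} {v} out with C? u | C? v
  ... | yes cu | yes cv = contradiction (cu , cv) out
  ... | yes _ | no _ = refl
  ... | no _ | _ = refl

module _ {n} (G : Graph n) {S : Pred₀ n} (S? : Dec₁ S) {o : Fin n → Fin n → Bool} (o-anti : Antisymmetric o) (β : ℕ) where

  open Closure (outArc? G S? o) S? β

  -- Pairs inside the core are free in the given span, so they can follow `o`. A walk from `S` to
  -- `v` spends at most `β` steps inside the core and then at most `ρ` outside; the way back is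
  -- symmetric.
  extend : ∀ {ρ} → Span G Core ρ → Span G S (β + ρ)
  extend {ρ} (o′ , o′-anti , link′) = splice , splice-antisym o-anti o′-anti , link
    where
    open Splice core? o o′

    inside : ∀ {u v} → Inner u v → OutArc G S splice u v
    inside ((e , t , out) , cu , cv) = e , trans (splice-inside cu cv) t , out

    outside : ∀ {u v} → OutArc G Core o′ u v → OutArc G S splice u v
    outside (e , t , out) = e , trans (splice-outside out) t , λ { (Su , Sv) → out (inj₁ Su , inj₁ Sv) }

    link : ∀ v → Linked (OutArc G S splice) S (β + ρ) v
    link v with link′ v
    ... | (k , k≤ , x , cx , α) , (l , l≤ , y , cy , ζ) with linked cx | linked cy
    ... | (i , i≤ , s , Ss , α′) , _ | _ , (j , j≤ , s′ , Ss′ , ζ′) =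
      (i + k , +-mono-≤ i≤ k≤ , s , Ss , mapʷ inside α′ ++ʷ mapʷ outside α) ,
      (l + j , ≤-trans (+-mono-≤ l≤ j≤) (≤-reflexive (+-comm ρ β)) , s′ , Ss′ , mapʷ outside ζ ++ʷ mapʷ inside ζ′)

-- Two-colouring with a neighbour of the other colour.

module _ {n} {N : Rel₀ n} (N-sym : Symmetric N) {T : Pred₀ n} where

  private
    Happy : (Fin n → Maybe Bool) → Fin n → Bool → Set
    Happy c v b = T v ⊎ ∃[ u ] (N v u × c u ≡ just (not b))

    Sound : (Fin n → Maybe Bool) → Set
    Sound c = ∀ v b → c v ≡ just b → Happy c v b

    _⊑_ : (Fin n → Maybe Bool) → (Fin n → Maybe Bool) → Set
    c ⊑ c′ = ∀ v b → c v ≡ just b → c′ v ≡ just b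

    happier : ∀ {c c′ v b} → c ⊑ c′ → Happy c v b → Happy c′ v b
    happier le (inj₁ t) = inj₁ t
    happier le (inj₂ (u , Nvu , eq)) = inj₂ (u , Nvu , le u _ eq)

    colour : (Fin n → Maybe Bool) → Fin n → Bool → Fin n → Maybe Bool
    colour c v b = updateAt c v (const (just b))

    colour-⊑ : ∀ {c v b} → c v ≡ nothing → c ⊑ colour c v b
    colour-⊑ {c} {v} none w b′ eq with w ≟ᶠ v
    ... | yes refl = contradiction (trans (≡-sym eq) none) λ ()
    ... | no w≢v = trans (updateAt-minimal w v c w≢v) eq

    colour-sound : ∀ {c v b} → c v ≡ nothing → Sound c → Happy (colour c v b) v b → Sound (colour c v b)
    colour-sound {c} {v} none snd hv w b′ eq with w ≟ᶠ v
    ... | no w≢v = happier (colour-⊑ none) (snd w b′ (trans (≡-sym (updateAt-minimal w v c w≢v)) eq))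
    ... | yes refl with trans (≡-sym eq) (updateAt-updates v c)
    ...   | refl = hv

    -- Colours are never changed, so satisfied vertices stay satisfied. If the partner already has a
    -- colour, `v` takes the opposite one; otherwise both are coloured at once and satisfy each
    -- other.
    paint : (∀ v → T v ⊎ ∃[ u ] (u ≢ v × N v u)) → ∀ c v → Sound c →
      ∃[ c′ ] (Sound c′ × c ⊑ c′ × ∃[ b ] (c′ v ≡ just b))
    paint partner c v snd with c v in eq
    ... | just b = c , snd , (λ _ _ e → e) , b , eq
    ... | nothing with partner v
    ...   | inj₁ t = colour c v true , colour-sound eq snd (inj₁ t) , colour-⊑ eq , true , updateAt-updates v c
    ...   | inj₂ (u , u≢v , Nvu) with c u in equ
    ...     | just b = colour c v (not b)
                     , colour-sound eq snd (inj₂ (u , Nvu , colour-⊑ eq u _ (trans equ (cong just (≡-sym (not-involutive b))))))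
                     , colour-⊑ eq , not b , updateAt-updates v c
    ...     | nothing = c₂ , snd₂ , (λ w b e → colour-⊑ none w b (colour-⊑ eq w b e)) , true
                      , colour-⊑ none v _ (updateAt-updates v c)
      where
      c₁ = colour c v true
      c₂ = colour c₁ u false
      none : c₁ u ≡ nothing
      none = trans (updateAt-minimal u v c u≢v) equ
      snd₂ : Sound c₂
      snd₂ w b e with w ≟ᶠ u
      ... | yes refl with trans (≡-sym e) (updateAt-updates u c₁)
      ...   | refl = inj₂ (v , N-sym Nvu , colour-⊑ none v _ (updateAt-updates v c))
      snd₂ w b e | no w≢u with w ≟ᶠ v
      ... | no w≢v = happier (λ x b′ e′ → colour-⊑ none x b′ (colour-⊑ eq x b′ e′))
            (snd w b (trans (≡-sym (trans (updateAt-minimal w u c₁ w≢u) (updateAt-minimal w v c w≢v))) e))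
      ... | yes refl with trans (≡-sym e) (trans (updateAt-minimal v u c₁ w≢u) (updateAt-updates v c))
      ...   | refl = inj₂ (u , Nvu , updateAt-updates u c₁)

    paintAll : (∀ v → T v ⊎ ∃[ u ] (u ≢ v × N v u)) → (vs : List (Fin n)) →
      ∃[ c ] (Sound c × (∀ v → v ∈ vs → ∃[ b ] (c v ≡ just b)))
    paintAll partner [] = (λ _ → nothing) , (λ _ _ ()) , λ _ ()
    paintAll partner (v ∷ vs) with paintAll partner vs
    ... | c , snd , full with paint partner c v snd
    ...   | c′ , snd′ , le , b , eq = c′ , snd′ , λ where
            _ (first refl) → b , eq
            w (later w∈) → proj₁ (full w w∈) , le w _ (proj₂ (full w w∈))

  two-colouring : (∀ v → T v ⊎ ∃[ u ] (u ≢ v × N v u)) →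
    Σ (Fin n → Bool) λ c → ∀ v → T v ⊎ ∃[ u ] (N v u × c u ≡ not (c v))
  two-colouring partner with paintAll partner (allFin n)
  ... | c , snd , full = c̄ , happy
    where
    c̄ : Fin n → Bool
    c̄ v = fromMaybe true (c v)
    happy : ∀ v → T v ⊎ ∃[ u ] (N v u × c̄ u ≡ not (c̄ v))
    happy v with full v (∈-allFin v)
    ... | b , eq with snd v b eq
    ...   | inj₁ t = inj₁ t
    ...   | inj₂ (u , Nvu , equ) = inj₂ (u , Nvu , trans (cong (fromMaybe true) equ) (cong (not ∘ fromMaybe true) (≡-sym eq)))

-- Branches of the breadth-first forest hanging from a set.

module Branches {n} (G : Graph n) {S : Pred₀ n} (S? : Dec₁ S) (L : Levels G S)
    (r : ℕ) (δ≤r : ∀ v → Levels.δ L v ≤ r) (β : ℕ) where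

  open Levels L

  -- The counter starts at the level of `v` and makes the climb structural. It stops at level 1, so
  -- a branch is named by its vertex next to `S`; vertices of `S` are their own roots.
  ancestor : ℕ → Fin n → Fin n
  ancestor (suc (suc k)) v = ancestor (suc k) (parent v)
  ancestor _ v = v

  root : Fin n → Fin n
  root v = ancestor (δ v) v

  root-self : δ v ≡ 1 → root v ≡ v
  root-self {v} eq = cong (λ k → ancestor k v) eq

  root-parent : δ v ≡ suc (suc k) → root (parent v) ≡ root v
  root-parent {v} eq = trans (cong (λ k → ancestor k (parent v)) (δ-parent eq))
                             (≡-sym (cong (λ k → ancestor k v) eq))

  -- With the tree paths to `S`, the edge `yz` closes a cycle of length `δ y + 1 + δ z`. The
  -- relation can hold between a branch and itself, so the colouring asks for a distinct partner.
  Link : Rel₀ n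
  Link u v = ∃[ y ] ∃[ z ] (¬ S y × ¬ S z × root y ≡ u × root z ≡ v × Edge G y z × δ y + δ z ≤ β)

  Link-sym : Symmetric Link
  Link-sym (y , z , ¬Sy , ¬Sz , ρy , ρz , e , le) =
    z , y , ¬Sz , ¬Sy , ρz , ρy , edge-sym G e , subst (_≤ β) (+-comm (δ y) (δ z)) le

  -- A second edge to `S` closes a cycle of length 2 after contraction. The premise exempts all
  -- vertices off level 1 from the colouring.
  Free : Pred₀ n
  Free v = δ v ≡ 1 → ∃[ z ] (S z × Edge G v z × parent v ≢ z × 1 ≤ β)

  -- The walk leaves the branch of v other than through the edge joining v to its parent.
  leave : ∀ {v y k l} → δ v ≡ 1 → k ⊓ (2 * r) ≤ β → Walk (EdgeMinus G v (parent v)) y (parent v) l →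
    ¬ S y → root y ≡ v → δ y + l ≤ suc k → Free v ⊎ ∃[ u ] (u ≢ v × Link v u)
  leave δv _ here ¬Sy _ _ = contradiction (0⇒S (δ-parent δv)) ¬Sy
  leave {v} {y} {k} δv k≤β (step {w = w} {k = l} (e , ≢₁ , _) ω) ¬Sy ρy le with S? w
  ... | yes Sw = inj₁ λ _ → w , Sw , subst (λ x → Edge G x w) y≡v e , (λ eq → ≢₁ (y≡v , ≡-sym eq)) , bound
    where
    δy : δ y ≡ 1
    δy with δ-suc ¬Sy
    ... | j , eq = trans eq (cong suc (n≤0⇒n≡0 (≤-pred (subst₂ _≤_ eq (cong suc (S⇒0 Sw)) (δ-edge e)))))
    y≡v : y ≡ v
    y≡v = trans (≡-sym (root-self δy)) ρy
    bound : 1 ≤ β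
    bound = ≤-trans (⊓-glb (≤-pred (≤-trans (≤-trans (s≤s (s≤s z≤n)) (≤-reflexive (cong (_+ suc l) (≡-sym δy)))) le))
      (≤-trans (subst (_≤ r) δv (δ≤r v)) (m≤m+n r _))) k≤β
  ... | no ¬Sw with root w ≟ᶠ v
  -- The level rises by at most 1 while the remaining walk loses a step, so the sum stays at most
  -- `suc k`.
  ...   | yes ρw = leave δv k≤β ω ¬Sw ρw (≤-trans (+-monoˡ-≤ l (δ-edge (edge-sym G e)))
                     (≤-trans (≤-reflexive (≡-sym (+-suc (δ y) l))) le))
  -- The rest of the walk ends in `S`, so `δ w ≤ l` and the levels sum to at most `k`; they also sum
  -- to at most `2 * r`, each being at most `r`.
  ...   | no ρw≢v = inj₂ (root w , ρw≢v , y , w , ¬Sy , ¬Sw , ρy , refl , e , ≤-trans (⊓-glb short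
            (≤-trans (+-mono-≤ (δ≤r y) (δ≤r w)) (≤-reflexive (cong (r +_) (≡-sym (+-identityʳ r)))))) k≤β)
    where
    δw : δ w ≤ l
    δw = subst (δ w ≤_) (trans (cong (l +_) (δ-parent δv)) (+-identityʳ l)) (δ-walk (mapʷ proj₁ ω))
    short : δ y + δ w ≤ k
    short = ≤-pred (≤-trans (≤-trans (≤-reflexive (≡-sym (+-suc (δ y) (δ w)))) (+-monoʳ-≤ (δ y) (s≤s δw))) le)

  module Coloured (c : Fin n → Bool) where

    -- Large enough that keys in branches coloured false, at least `r + 2`, exceed those in branches
    -- coloured true, at most `r`. Edges between the colours thus lead from true to false.
    B : ℕ
    B = suc (suc (r + r))

    level : Bool → ℕ → ℕ
    level true k = k
    level false k = B ∸ k

    -- Arcs lead away from S in the branches coloured true and towards S in the others. A vertex of S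
    -- counts as lowest in a branch coloured true when seen from its child, and as highest otherwise.
    key : Fin n → Fin n → ℕ
    key u v with S? u | parent v ≟ᶠ u
    ... | no _ | _ = level (c (root u)) (δ u)
    ... | yes _ | yes _ = level (c (root v)) 0
    ... | yes _ | no _ = level (not (c (root v))) 0

    key-outside : ¬ S u → key u v ≡ level (c (root u)) (δ u)
    key-outside {u} {v} ¬Su with S? u | parent v ≟ᶠ u
    ... | no _ | _ = refl
    ... | yes Su | _ = contradiction Su ¬Su

    key-parent : δ v ≡ suc k → key (parent v) v ≡ level (c (root v)) k
    key-parent {v} {k} eq with S? (parent v) | parent v ≟ᶠ parent v
    ... | yes Sp | yes _ = cong (level (c (root v))) (trans (≡-sym (S⇒0 Sp)) (δ-parent eq))
    ... | _ | no p≢ = contradiction refl p≢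
    key-parent {v} {zero} eq | no ¬Sp | yes _ = contradiction (0⇒S (δ-parent eq)) ¬Sp
    key-parent {v} {suc k} eq | no ¬Sp | yes _ = cong₂ level (cong c (root-parent eq)) (δ-parent eq)

    key-extra : S u → parent v ≢ u → key u v ≡ level (not (c (root v))) 0
    key-extra {u} {v} Su p≢ with S? u | parent v ≟ᶠ u
    ... | no ¬Su | _ = contradiction Su ¬Su
    ... | yes _ | yes eq = contradiction eq p≢
    ... | yes _ | no _ = refl

    o : Fin n → Fin n → Bool
    o = byKey key

    A : Rel₀ n
    A = OutArc G S o

    δ<B : ∀ v → δ v < B
    δ<B v = s≤s (≤-trans (δ≤r v) (≤-trans (m≤m+n r r) (n≤1+n _)))

    arc-down : c (root v) ≡ true → δ v ≡ suc k → A (parent v) v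
    arc-down {v} {k} cv eq = edge-sym G (parent-edge eq) , byKey-true key lt , λ { (_ , Sv) → suc⇒¬S eq Sv }
      where
      lt : key (parent v) v < key v (parent v)
      lt rewrite key-parent {v} {k} eq | key-outside {v} {parent v} (suc⇒¬S eq) | cv | eq = ≤-refl

    arc-up : c (root v) ≡ false → δ v ≡ suc k → A v (parent v)
    arc-up {v} {k} cv eq = parent-edge eq , byKey-true key lt , λ { (Sv , _) → suc⇒¬S eq Sv }
      where
      lt : key v (parent v) < key (parent v) v
      lt rewrite key-parent {v} {k} eq | key-outside {v} {parent v} (suc⇒¬S eq) | cv | eq =
        ∸-monoʳ-< ≤-refl (<⇒≤ (subst (_< B) eq (δ<B v)))

    arc-cross : c (root u) ≡ true → c (root v) ≡ false → ¬ S u → ¬ S v → Edge G u v → A u v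
    arc-cross {u} {v} cu cv ¬Su ¬Sv e = e , byKey-true key lt , λ { (Su , _) → ¬Su Su }
      where
      lt : key u v < key v u
      lt rewrite key-outside {u} {v} ¬Su | key-outside {v} {u} ¬Sv | cu | cv =
        m+n≤o⇒m≤o∸n (suc (δ u)) (s≤s (≤-trans (+-mono-≤ (δ≤r u) (δ≤r v)) (n≤1+n _)))

    arc-exit : c (root v) ≡ true → ¬ S v → S u → parent v ≢ u → Edge G v u → A v u
    arc-exit {v} {u} cv ¬Sv Su p≢ e = e , byKey-true key lt , λ { (Sv , _) → ¬Sv Sv }
      where
      lt : key v u < key u v
      lt rewrite key-outside {v} {u} ¬Sv | key-extra {u} {v} Su p≢ | cv = δ<B v

    arc-enter : c (root v) ≡ false → ¬ S v → S u → parent v ≢ u → Edge G v u → A u v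
    arc-enter {v} {u} cv ¬Sv Su p≢ e = edge-sym G e , byKey-true key lt , λ { (_ , Sv) → ¬Sv Sv }
      where
      lt : key u v < key v u
      lt rewrite key-outside {v} {u} ¬Sv | key-extra {u} {v} Su p≢ | cv = m<n⇒0<n∸m (δ<B v)

    -- The arc from `S` is kept apart because `link-core` cuts the cycle at the root.
    from-root : δ v ≡ suc k → c (root v) ≡ true → Reached A S (root v) 1 × Walk A (root v) v k
    from-root {v} {zero} eq cv rewrite root-self eq =
      (parent v , 0⇒S (δ-parent eq) , step (arc-down (trans (cong c (root-self eq)) cv) eq) here) , here
    from-root {v} {suc k} eq cv with from-root (δ-parent eq) (trans (cong c (root-parent eq)) cv)
    ... | α , ω rewrite root-parent eq = α , ω ∷ʳʷ arc-down cv eq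

    to-root : δ v ≡ suc k → c (root v) ≡ false → Walk A v (root v) k × Reach A S (root v) 1
    to-root {v} {zero} eq cv rewrite root-self eq =
      here , parent v , 0⇒S (δ-parent eq) , step (arc-up (trans (cong c (root-self eq)) cv) eq) here
    to-root {v} {suc k} eq cv with to-root (δ-parent eq) (trans (cong c (root-parent eq)) cv)
    ... | ω , ζ rewrite root-parent eq = step (arc-up cv eq) ω , ζ

    open Closure (outArc? G S? o) S? β

    -- The cycle runs from `S` through `u`, `y`, `z`, `v` back to `S` and has length
    -- `δ y + 1 + δ z`; it is cut once at `u` and once at `v`.
    link-core : c u ≡ true → c v ≡ false → Link u v → Core u × Core v
    link-core {u} {v} cu cv (y , z , ¬Sy , ¬Sz , ρy , ρz , e , le)
      with δ-suc ¬Sy | δ-suc ¬Sz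
    ... | j , δy | i , δz
      with from-root δy (trans (cong c ρy) cu) | to-root δz (trans (cong c ρz) cv)
    ... | (s , Ss , α) , ω | η , (t , St , ζ)
      rewrite ρy | ρz =
      loop (s , Ss , α) (t , St , ω ++ʷ step a (η ++ʷ ζ)) (≤-trans (≤-reflexive eq₁) (s≤s le)) ,
      loop (s , Ss , α ++ʷ (ω ++ʷ step a η)) (t , St , ζ) (≤-trans (≤-reflexive eq₂) (s≤s le))
      where
      a : A y z
      a = arc-cross (trans (cong c ρy) cu) (trans (cong c ρz) cv) ¬Sy ¬Sz e
      eq₁ : 1 + (j + suc (i + 1)) ≡ 1 + (δ y + δ z)
      eq₁ rewrite δy | δz | +-comm i 1 = cong suc (+-suc j (suc i))
      eq₂ : 1 + (j + suc i) + 1 ≡ 1 + (δ y + δ z)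
      eq₂ rewrite δy | δz = +-comm (1 + (j + suc i)) 1

    free-core : δ v ≡ 1 → Free v → Core v
    free-core {v} δv free with free δv | c v in cv
    ... | z , Sz , e , p≢ , 1≤β | true = loop
          (parent v , 0⇒S (δ-parent δv) , step (arc-down cρ δv) here)
          (z , Sz , step (arc-exit cρ (suc⇒¬S δv) Sz p≢ e) here) (s≤s 1≤β)
      where
      cρ : c (root v) ≡ true
      cρ = trans (cong c (root-self δv)) cv
    ... | z , Sz , e , p≢ , 1≤β | false = loop
          (z , Sz , step (arc-enter cρ (suc⇒¬S δv) Sz p≢ e) here)
          (parent v , 0⇒S (δ-parent δv) , step (arc-up cρ δv) here) (s≤s 1≤β)
      where
      cρ : c (root v) ≡ false
      cρ = trans (cong c (root-self δv)) cv

    neighbour-core : δ v ≡ 1 → Free v ⊎ ∃[ u ] (Link v u × c u ≡ not (c v)) → Core v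
    neighbour-core δv (inj₁ free) = free-core δv free
    neighbour-core {v} δv (inj₂ (u , link , cu)) with c v in cv
    ... | true = proj₁ (link-core cv cu link)
    ... | false = proj₂ (link-core cu cv (Link-sym link))

-- Iterating the rounds.

-- The minimum covers both regimes: detours of length at most `4 * t` allow `β = 4 * t`, and
-- arbitrary detours allow `β = 2 * r`.
Returns : Graph n → ℕ → ℕ → Set
Returns G r β = ∀ u v → Edge G u v → ∃[ k ] (Walk (EdgeMinus G u v) u v k × k ⊓ (2 * r) ≤ β)

Within : Graph n → Pred₀ n → ℕ → Set
Within G S r = ∀ v → ∃[ k ] (k ≤ r × Reach (Edge G) S v k)

total : (ℕ → ℕ) → ℕ → ℕ
total b zero = 0
total b (suc r) = b (suc r) + total b r

-- A round puts all of level 1 into the core, so every vertex outside `S` gets at least one step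
-- closer and the radius drops by one.
span : (G : Graph n) (b : ℕ → ℕ) → (∀ r → Returns G r (b r)) →
  ∀ r {S : Pred₀ n} → Dec₁ S → Within G S r → Span G S (total b r)
span G b ret zero S? near = byKey (λ _ _ → 0) , byKey-antisym _ , λ v → link v (near v)
  where
  link : ∀ v → ∃[ k ] (k ≤ 0 × Reach (Edge G) _ v k) → Linked (OutArc G _ _) _ 0 v
  link v (zero , _ , _ , Sv , here) = (0 , z≤n , v , Sv , here) , (0 , z≤n , v , Sv , here)
span {n} G b ret (suc r) {S} S? near = extend G S? (byKey-antisym _) (b (suc r)) (span G b ret r core? near′)
  where
  L : Levels G S
  L = levels G S? λ v → proj₁ (near v) , proj₂ (proj₂ (near v))
  open Levels L
  δ≤r : ∀ v → δ v ≤ suc r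
  δ≤r v = ≤-trans (least (proj₂ (proj₂ (near v)))) (proj₁ (proj₂ (near v)))
  open Branches G S? L (suc r) δ≤r (b (suc r))
  partner : ∀ v → Free v ⊎ ∃[ u ] (u ≢ v × Link v u)
  partner v with δ v ≟ 1
  ... | no δ≢1 = inj₁ λ eq → contradiction eq δ≢1
  ... | yes eq with ret (suc r) v (parent v) (parent-edge eq)
  ...   | k , ω , le = leave eq le ω (suc⇒¬S eq) (root-self eq) (≤-reflexive (cong (_+ k) eq))
  colouring : Σ (Fin n → Bool) λ c → ∀ v → Free v ⊎ ∃[ u ] (Link v u × c u ≡ not (c v))
  colouring = two-colouring Link-sym partner
  open Coloured (proj₁ colouring)
  open Closure (outArc? G S? o) S? (b (suc r))
  climb : ∀ k v → δ v ≡ suc k → Reach (Edge G) Core v k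
  climb zero v eq = v , neighbour-core eq (proj₂ colouring v) , here
  climb (suc k) v eq with climb k (parent v) (δ-parent eq)
  ... | x , cx , ω = x , cx , step (parent-edge eq) ω
  near′ : Within G Core r
  near′ v with δ v in eq | δ≤r v
  ... | zero | _ = 0 , z≤n , v , inj₁ (0⇒S eq) , here
  ... | suc k | s≤s k≤r = k , k≤r , climb k v eq

-- The threshold and the numerical bounds.

quotient-upper : ∀ m k .{{_ : NonZero k}} → m ≤ k + m / k * k
quotient-upper m k = ≤-trans (≤-reflexive (m≡m%n+[m/n]*n m k)) (+-monoˡ-≤ (m / k * k) (<⇒≤ (m%n<n m k)))

-- The limit τ = 0.1715 of threshold d / d lies in the narrow range where 8τ ≤ 1.373 (all edges in cycles of
-- length at most 4t + 1) and 2(1 − τ)² ≤ 1.373 (some edge in no such cycle).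
abstract
  threshold : ℕ → ℕ
  threshold d = (d * 686 + 2900) / 4000

  threshold-lower : ∀ d → threshold d * 4000 ≤ d * 686 + 2900
  threshold-lower d = m/n*n≤m (d * 686 + 2900) 4000

  threshold-upper : ∀ d → d * 686 + 2900 ≤ 4000 + threshold d * 4000
  threshold-upper d = quotient-upper (d * 686 + 2900) 4000

-- The offset 2900 contributes `5800 * d`, and `1 ≤ d` turns the additive 1000 into `1000 * d`;
-- together they fit into `6971 * d`.
short-bound : ∀ d t → 1 ≤ d → t * 4000 ≤ d * 686 + 2900 →
  1000 * (2 * (d * (4 * t))) + 1000 ≤ 1373 * (d * d) + 6971 * d
short-bound d t 1≤d t≤ = begin
  1000 * (2 * (d * (4 * t))) + 1000       ≡⟨ eq₁ d t ⟩
  2 * d * (t * 4000) + 1 * 1000           ≤⟨ +-mono-≤ (*-monoʳ-≤ (2 * d) t≤) (*-monoˡ-≤ 1000 1≤d) ⟩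
  2 * d * (d * 686 + 2900) + d * 1000     ≤⟨ m≤m+n _ (d * d + d * 171) ⟩
  2 * d * (d * 686 + 2900) + d * 1000 + (d * d + d * 171)  ≡⟨ eq₂ d ⟩
  1373 * (d * d) + 6971 * d               ∎
  where
  open ≤-Reasoning
  eq₁ : ∀ d t → 1000 * (2 * (d * (4 * t))) + 1000 ≡ 2 * d * (t * 4000) + 1 * 1000
  eq₁ = solve 2 (λ d t → con 1000 :* (con 2 :* (d :* (con 4 :* t))) :+ con 1000
                      := con 2 :* d :* (t :* con 4000) :+ con 1 :* con 1000) refl
  eq₂ : ∀ d → 2 * d * (d * 686 + 2900) + d * 1000 + (d * d + d * 171) ≡ 1373 * (d * d) + 6971 * d
  eq₂ = solve 1 (λ d → con 2 :* d :* (d :* con 686 :+ con 2900) :+ d :* con 1000 :+ (d :* d :+ d :* con 171)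
                    := con 1373 :* (d :* d) :+ con 6971 :* d) refl

-- Since `r * suc r` is below the square of `r + 1/2`, it suffices that `r + 1/2 ≤ 0.8285 d`,
-- because `2 * 0.8285² < 1.373`.
long-bound : ∀ d t r → 1 ≤ d → r + suc t ≡ d → d * 686 + 2900 ≤ 4000 + t * 4000 →
  1000 * (2 * (2 * d + r * suc r)) + 1000 ≤ 1373 * (d * d) + 6971 * d
long-bound d t r 1≤d r+t≡d t≥ = begin
  1000 * (2 * (2 * d + r * suc r)) + 1000        ≡⟨ eq₁ d (r * suc r) ⟩
  r * suc r * 2000 + d * 4000 + 1 * 1000         ≤⟨ +-mono-≤ (+-monoˡ-≤ (d * 4000) quadratic) (*-monoˡ-≤ 1000 1≤d) ⟩
  d * d * 1373 + d * 4000 + d * 1000             ≤⟨ m≤m+n _ (d * 1971) ⟩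
  d * d * 1373 + d * 4000 + d * 1000 + d * 1971  ≡⟨ eq₂ d ⟩
  1373 * (d * d) + 6971 * d                      ∎
  where
  open ≤-Reasoning
  eq₁ : ∀ d x → 1000 * (2 * (2 * d + x)) + 1000 ≡ x * 2000 + d * 4000 + 1 * 1000
  eq₁ = solve 2 (λ d x → con 1000 :* (con 2 :* (con 2 :* d :+ x)) :+ con 1000
                      := x :* con 2000 :+ d :* con 4000 :+ con 1 :* con 1000) refl
  eq₂ : ∀ d → d * d * 1373 + d * 4000 + d * 1000 + d * 1971 ≡ 1373 * (d * d) + 6971 * d
  eq₂ = solve 1 (λ d → d :* d :* con 1373 :+ d :* con 4000 :+ d :* con 1000 :+ d :* con 1971
                    := con 1373 :* (d :* d) :+ con 6971 :* d) refl
  square : ∀ c r → r * suc r * (4 * (c * c)) + c * c ≡ (r * (2 * c) + c) * (r * (2 * c) + c)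
  square = solve 2 (λ c r → r :* (con 1 :+ r) :* (con 4 :* (c :* c)) :+ c :* c
                         := (r :* (con 2 :* c) :+ c) :* (r :* (con 2 :* c) :+ c)) refl
  -- The offset 2900 in the threshold leaves room for the 2000 that completes the square.
  linear : r * 4000 + 2000 ≤ d * 3314
  linear = ≤-trans (+-monoʳ-≤ (r * 4000) (≤ᵇ⇒≤ 2000 2900 tt)) (+-cancelʳ-≤ (d * 686) _ _ (begin
    r * 4000 + 2900 + d * 686      ≡⟨ +-assoc (r * 4000) 2900 (d * 686) ⟩
    r * 4000 + (2900 + d * 686)    ≡⟨ cong (r * 4000 +_) (+-comm 2900 (d * 686)) ⟩
    r * 4000 + (d * 686 + 2900)    ≤⟨ +-monoʳ-≤ (r * 4000) t≥ ⟩
    r * 4000 + suc t * 4000        ≡⟨ *-distribʳ-+ 4000 r (suc t) ⟨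
    (r + suc t) * 4000             ≡⟨ cong (_* 4000) r+t≡d ⟩
    d * (3314 + 686)               ≡⟨ *-distribˡ-+ d 3314 686 ⟩
    d * 3314 + d * 686             ∎))
  quadratic : r * suc r * 2000 ≤ d * d * 1373
  quadratic = *-cancelʳ-≤ _ _ 8000 (begin
    r * suc r * 2000 * 8000                  ≡⟨ *-assoc (r * suc r) 2000 8000 ⟩
    r * suc r * (4 * (2000 * 2000))          ≤⟨ m≤m+n _ (2000 * 2000) ⟩
    r * suc r * (4 * (2000 * 2000)) + 2000 * 2000  ≡⟨ square 2000 r ⟩
    (r * 4000 + 2000) * (r * 4000 + 2000)    ≤⟨ *-mono-≤ linear linear ⟩
    d * 3314 * (d * 3314)                    ≡⟨ [m*n]*[o*p]≡[m*o]*[n*p] d 3314 d 3314 ⟩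
    d * d * (3314 * 3314)                    ≤⟨ *-monoʳ-≤ (d * d) (≤ᵇ⇒≤ (3314 * 3314) (1373 * 8000) tt) ⟩
    d * d * (1373 * 8000)                    ≡⟨ *-assoc (d * d) 1373 8000 ⟨
    d * d * 1373 * 8000                      ∎)

-- By parity. The surplus 1 arises in `cross-right`, where `δp u` may exceed `δq w` by one.
halve : ∀ a b → 2 * a ≤ suc (2 * b) → a ≤ b
halve a b le = ≤-pred (*-cancelˡ-< 2 a (suc b) (≤-trans (s≤s le) (≤-reflexive (cong suc (≡-sym (+-suc b (b + 0)))))))

-- The core around an edge in no short cycle.

module LongCycle {n} (G : Graph n) {d : ℕ} (diam : DiamLe (Edge G) d) {p q : Fin n} (pq : Edge G p q)
    (bridgeless : Connected (EdgeMinus G p q)) (t : ℕ)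
    (far : ∀ {k} → k ≤ 4 * t → ¬ Walk (EdgeMinus G p q) p q k) where

  levelsFrom : ∀ s → Levels G (_≡ s)
  levelsFrom s = levels G (_≟ᶠ s) λ v → proj₁ (diam v s) , s , refl , proj₂ (proj₂ (diam v s))

  module Lp = Levels (levelsFrom p)
  module Lq = Levels (levelsFrom q)
  open Lp using () renaming (δ to δp)
  open Lq using () renaming (δ to δq)

  δp≤d : ∀ v → δp v ≤ d
  δp≤d v = ≤-trans (Lp.least (p , refl , proj₂ (proj₂ (diam v p)))) (proj₁ (proj₂ (diam v p)))

  δq≤d : ∀ v → δq v ≤ d
  δq≤d v = ≤-trans (Lq.least (q , refl , proj₂ (proj₂ (diam v q)))) (proj₁ (proj₂ (diam v q)))

  Left : Pred₀ n
  Left v = δp v ≤ δq v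

  left? : Dec₁ Left
  left? v = δp v ≤? δq v

  left-p : Left p
  left-p = subst (_≤ δq p) (≡-sym (Lp.S⇒0 refl)) z≤n

  right-q : ¬ Left q
  right-q le = edge-≢ G pq (≡-sym (Lp.0⇒S (n≤0⇒n≡0 (subst (δp q ≤_) (Lq.S⇒0 refl) le))))

  -- Heights are at most `d` on the left and at least `d + 1` on the right, so edges from left to
  -- right ascend.
  B : ℕ
  B = 1 + 2 * d

  height : Fin n → ℕ
  height v with left? v
  ... | yes _ = δp v
  ... | no _ = B ∸ δq v

  height-left : Left v → height v ≡ δp v
  height-left {v} le with left? v
  ... | yes _ = refl
  ... | no ¬le = contradiction le ¬le

  height-right : ¬ Left v → height v ≡ B ∸ δq v
  height-right {v} ¬le with left? v
  ... | yes le = contradiction le ¬le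
  ... | no _ = refl

  Climb : Rel₀ n
  Climb u v = Edge G u v × height u < height v × ¬ (u ≡ p × v ≡ q)

  -- A step towards `p` stays on the left: `δp u + 1 = δp v ≤ δq v ≤ δq u + 1`.
  left-parent : δp v ≡ suc k → Left v → ∃[ u ] (Left u × δp u ≡ k × Climb u v)
  left-parent {v} {k} eq lv = Lp.parent v , lu , δu , edge-sym G e , lt , λ { (_ , refl) → right-q lv }
    where
    e : Edge G v (Lp.parent v)
    e = Lp.parent-edge eq
    δu : δp (Lp.parent v) ≡ k
    δu = Lp.δ-parent eq
    lu : Left (Lp.parent v)
    lu = ≤-pred (≤-trans (≤-reflexive (trans (cong suc δu) (≡-sym eq))) (≤-trans lv (Lq.δ-edge e)))
    lt : height (Lp.parent v) < height v
    lt rewrite height-left lu | height-left lv | δu | eq = ≤-refl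

  right-parent : δq v ≡ suc k → ¬ Left v → ∃[ w ] (¬ Left w × δq w ≡ k × Climb v w)
  right-parent {v} {k} eq rv = Lq.parent v , <⇒≱ lw , δw , e , lt , λ { (refl , _) → rv left-p }
    where
    e : Edge G v (Lq.parent v)
    e = Lq.parent-edge eq
    δw : δq (Lq.parent v) ≡ k
    δw = Lq.δ-parent eq
    lw : δq (Lq.parent v) < δp (Lq.parent v)
    lw = ≤-pred (≤-trans (≤-reflexive (cong suc (trans (cong suc δw) (≡-sym eq)))) (≤-trans (≰⇒> rv) (Lp.δ-edge e)))
    lt : height v < height (Lq.parent v)
    lt rewrite height-right rv | height-right (<⇒≱ lw) | δw | eq =
      ∸-monoʳ-< ≤-refl (≤-trans (subst (_≤ d) eq (δq≤d v)) (≤-trans (m≤m+n d (d + 0)) (n≤1+n _)))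

  left-walk : ∀ k {v} → δp v ≡ k → Left v → Walk Climb p v k
  left-walk zero eq _ = subst (λ x → Walk Climb p x 0) (≡-sym (Lp.0⇒S eq)) here
  left-walk (suc k) eq lv with left-parent eq lv
  ... | u , lu , δu , c = left-walk k δu lu ∷ʳʷ c

  right-walk : ∀ k {v} → δq v ≡ k → ¬ Left v → Walk Climb v q k
  right-walk zero eq _ = subst (λ x → Walk Climb x q 0) (≡-sym (Lq.0⇒S eq)) here
  right-walk (suc k) eq rv with right-parent eq rv
  ... | w , rw , δw , c = step c (right-walk k δw rw)

  left-at : ∀ m {j v} → δp v ≡ m + j → Left v → ∃[ u ] (Left u × δp u ≡ j)
  left-at zero eq lv = _ , lv , eq
  left-at (suc m) eq lv with left-parent eq lv
  ... | u , lu , δu , _ = left-at m δu lu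

  right-at : ∀ m {j v} → δq v ≡ m + j → ¬ Left v → ∃[ w ] (¬ Left w × δq w ≡ j)
  right-at zero eq rv = _ , rv , eq
  right-at (suc m) eq rv with right-parent eq rv
  ... | w , rw , δw , _ = right-at m δw rw

  climb⇒edgeMinus : Climb u v → EdgeMinus G p q u v
  climb⇒edgeMinus (e , lt , ≢pq) = e , ≢pq , λ { (refl , refl) →
    contradiction (subst (height q <_) (trans (height-left left-p) (Lp.S⇒0 refl)) lt) λ () }

  Cross : Rel₀ n
  Cross u w = Left u × ¬ Left w × Edge G u w × ¬ (u ≡ p × w ≡ q)

  cross-climb : Cross u w → Climb u w
  cross-climb {u} {w} (lu , rw , e , ≢pq) = e , lt , ≢pq
    where
    lt : height u < height w
    lt rewrite height-left lu | height-right rw = m+n≤o⇒m≤o∸n (suc (δp u))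
      (s≤s (≤-trans (+-mono-≤ (δp≤d u) (δq≤d w)) (≤-reflexive (cong (d +_) (≡-sym (+-identityʳ d))))))

  -- Otherwise the ascending walk from `p` through `uw` to `q` would be a detour around `pq` of
  -- length at most `4 * t`.
  cross-far : Cross u w → 4 * t ≤ δp u + δq w
  cross-far {u} {w} x@(lu , rw , _) = ≤-pred (≤-trans (≰⇒> λ le → far le path) (≤-reflexive (+-suc (δp u) (δq w))))
    where
    path : Walk (EdgeMinus G p q) p q (δp u + suc (δq w))
    path = mapʷ climb⇒edgeMinus (left-walk _ refl lu ++ʷ step (cross-climb x) (right-walk _ refl rw))

  double : 2 * (2 * t) ≡ 4 * t
  double = ≡-sym (*-assoc 2 2 t)

  -- From `δq w < δp w ≤ δp u + 1` follows `δq w ≤ δp u`, so `δp u` is at least half of `4 * t`.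
  cross-left : Cross u w → 2 * t ≤ δp u
  cross-left {u} {w} x@(lu , rw , e , _) = halve (2 * t) (δp u) (≤-trans (≤-reflexive double)
    (≤-trans (cross-far x) (≤-trans (+-monoʳ-≤ (δp u) low) (≤-trans (n≤1+n _) (≤-reflexive (cong (λ m → suc (δp u + m)) (≡-sym (+-identityʳ _))))))))
    where
    low : δq w ≤ δp u
    low = ≤-pred (≤-trans (≰⇒> rw) (Lp.δ-edge (edge-sym G e)))

  cross-right : Cross u w → 2 * t ≤ δq w
  cross-right {u} {w} x@(lu , rw , e , _) = halve (2 * t) (δq w) (≤-trans (≤-reflexive double)
    (≤-trans (cross-far x) (≤-trans (+-monoˡ-≤ (δq w) (≤-trans lu (Lq.δ-edge e)))
      (≤-reflexive (cong (λ m → suc (δq w + m)) (≡-sym (+-identityʳ _)))))))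

  -- Arcs ascend, except the one from q down to p.
  key : Fin n → Fin n → ℕ
  key u v with (u ≟ᶠ q) ×-dec (v ≟ᶠ p)
  ... | yes _ = 0
  ... | no _ = suc (height u)

  key-qp : key q p ≡ 0
  key-qp with (q ≟ᶠ q) ×-dec (p ≟ᶠ p)
  ... | yes _ = refl
  ... | no ≢qp = contradiction (refl , refl) ≢qp

  key-height : ¬ (u ≡ q × v ≡ p) → key u v ≡ suc (height u)
  key-height {u} {v} ≢qp with (u ≟ᶠ q) ×-dec (v ≟ᶠ p)
  ... | yes eq = contradiction eq ≢qp
  ... | no _ = refl

  o : Fin n → Fin n → Bool
  o = byKey key

  A : Rel₀ n
  A = OutArc G (_≡ p) o

  arc-key : Edge G u v → key u v < key v u → A u v
  arc-key e lt = e , byKey-true key lt , λ { (refl , refl) → edge-≢ G e refl }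

  arc-qp : A q p
  arc-qp = arc-key (edge-sym G pq) (subst₂ _<_ (≡-sym key-qp) (≡-sym (key-height λ { (eq , _) → edge-≢ G pq eq })) (s≤s z≤n))

  arc-climb : Climb u v → A u v
  arc-climb c@(e , lt , ≢pq) = arc-key e (subst₂ _<_
    (≡-sym (key-height (proj₂ (proj₂ (climb⇒edgeMinus c)))))
    (≡-sym (key-height λ { (eq , eq′) → ≢pq (eq′ , eq) })) (s≤s lt))

  open Closure (outArc? G (_≟ᶠ p) o) (_≟ᶠ p) (2 * d)

  -- All three lie on the directed cycle through `p`, `u`, `w`, `q`. Its length `δp u + δq w + 2` is
  -- at most `2 * d + 1` because `δq w < δp w ≤ d`.
  cross-core : Cross u w → Core u × Core w × Core q
  cross-core {u} {w} x@(lu , rw , _) =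
    loop (p , refl , up) (p , refl , step across (down ∷ʳʷ arc-qp)) bound ,
    loop (p , refl , up ∷ʳʷ across) (p , refl , down ∷ʳʷ arc-qp) (subst (_≤ B) (+-suc (δp u) (suc (δq w))) bound) ,
    loop (p , refl , up ++ʷ step across down) (p , refl , step arc-qp here)
      (subst (_≤ B) (trans (cong (δp u +_) (+-comm 1 (suc (δq w)))) (≡-sym (+-assoc (δp u) (suc (δq w)) 1))) bound)
    where
    up : Walk A p u (δp u)
    up = mapʷ arc-climb (left-walk _ refl lu)
    across : A u w
    across = arc-climb (cross-climb x)
    down : Walk A w q (δq w)
    down = mapʷ arc-climb (right-walk _ refl rw)
    bound : δp u + suc (suc (δq w)) ≤ B
    bound = ≤-trans (≤-reflexive (+-suc (δp u) (suc (δq w)))) (s≤s (+-mono-≤ (δp≤d u)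
      (≤-trans (≰⇒> rw) (≤-trans (δp≤d w) (≤-reflexive (≡-sym (+-identityʳ d)))))))

  someCross : ∃[ u ] ∃[ w ] Cross u w
  someCross with exit left? (proj₂ (bridgeless p q)) left-p right-q
  ... | u , w , _ , _ , _ , (e , ≢pq , _) , _ , lu , rw , _ = u , w , lu , rw , e , ≢pq

  core-q : Core q
  core-q = proj₂ (proj₂ (cross-core (proj₂ (proj₂ someCross))))

  t-drop : ∀ {x y j} → 2 * t ≤ x → x ≤ j + y → y ≡ t → t ≤ j
  t-drop {j = j} t≤x x≤ refl = +-cancelʳ-≤ t t j
    (≤-trans (≤-reflexive (cong (t +_) (≡-sym (+-identityʳ t)))) (≤-trans t≤x x≤))

  -- The left end of a crossing edge has level at least `2 * t`, and levels fall one at a time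
  -- towards `p`.
  leftTarget : ∃[ x ] (Left x × δp x ≡ t)
  leftTarget with someCross
  ... | u , w , x@(lu , _) = left-at (δp u ∸ t)
        (≡-sym (m∸n+n≡m (≤-trans (m≤m+n t (t + 0)) (cross-left x)))) lu

  rightTarget : ∃[ x ] (¬ Left x × δq x ≡ t)
  rightTarget with someCross
  ... | u , w , x@(_ , rw , _) = right-at (δq w ∸ t)
        (≡-sym (m∸n+n≡m (≤-trans (m≤m+n t (t + 0)) (cross-right x)))) rw

  -- A walk to a vertex at level t on the other side crosses over at least t steps before its end:
  -- through pq because of that level, otherwise because crossing edges lie at level ≥ 2t.
  leave-left : ∀ {x j} → δq x ≡ t → Left u → ¬ Left w → Edge G u w → Walk (Edge G) w x j → Core u × t ≤ j
  leave-left {u} {w} {x} {j} δx lu rw e ζ with (u ≟ᶠ p) ×-dec (w ≟ᶠ q)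
  ... | yes (u≡p , w≡q) = inj₁ u≡p ,
        subst₂ _≤_ δx (trans (cong (j +_) (Lq.S⇒0 w≡q)) (+-identityʳ j)) (Lq.δ-walk (reverse G ζ))
  ... | no ≢pq = proj₁ (cross-core (lu , rw , e , ≢pq)) ,
        t-drop (cross-right (lu , rw , e , ≢pq)) (Lq.δ-walk ζ) δx

  leave-right : ∀ {x j} → δp x ≡ t → ¬ Left w → Left u → Edge G w u → Walk (Edge G) u x j → Core w × t ≤ j
  leave-right {w} {u} {x} {j} δx rw lu e ζ with (u ≟ᶠ p) ×-dec (w ≟ᶠ q)
  ... | yes (u≡p , w≡q) = subst Core (≡-sym w≡q) core-q ,
        subst₂ _≤_ δx (trans (cong (j +_) (Lp.S⇒0 u≡p)) (+-identityʳ j)) (Lp.δ-walk (reverse G ζ))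
  ... | no ≢pq = proj₁ (proj₂ (cross-core (lu , rw , edge-sym G e , ≢pq))) ,
        t-drop (cross-left (lu , rw , edge-sym G e , ≢pq)) (Lp.δ-walk ζ) δx

  Dominated : Pred₀ n
  Dominated v = ∃[ i ] (i + suc t ≤ d × Reach (Edge G) Core v i)

  -- After `u` the walk still has the crossing edge and at least `t` further steps, out of at most
  -- `d` in all.
  arrive : ∀ {i j l} → i + suc j ≡ l → l ≤ d → Walk (Edge G) v u i → Core u × t ≤ j → Dominated v
  arrive {i = i} refl l≤d α (cu , t≤j) = i , ≤-trans (+-monoʳ-≤ i (s≤s t≤j)) l≤d , _ , cu , α

  dominated-left : Left v → Dominated v
  dominated-left {v} lv =
    let (x , rx , δx) = rightTarget
        (l , l≤d , ω) = diam v x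
        (u , w , i , j , α , e , ζ , lu , rw , eq) = exit left? ω lv rx
    in arrive eq l≤d α (leave-left δx lu rw e ζ)

  dominated-right : ¬ Left v → Dominated v
  dominated-right {v} rv =
    let (x , lx , δx) = leftTarget
        (l , l≤d , ω) = diam v x
        (w , u , i , j , α , e , ζ , rw , ¬ru , eq) = exit (λ y → ¬? (left? y)) ω rv (λ rx → rx lx)
    in arrive eq l≤d α (leave-right δx rw (decidable-stable (left? u) ¬ru) e ζ)

  dominated : ∀ v → Dominated v
  dominated v with left? v
  ... | yes lv = dominated-left lv
  ... | no rv = dominated-right rv

  radius : ℕ
  radius = d ∸ suc t

  radius-eq : radius + suc t ≡ d
  -- Domination of any vertex shows `suc t ≤ d`, so the subtraction is not truncated.
  radius-eq with dominated p
  ... | i , le , _ = m∸n+n≡m (≤-trans (m≤n+m (suc t) i) le)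

  near : Within G Core radius
  near v with dominated v
  ... | i , le , ρ = i , m+n≤o⇒m≤o∸n i le , ρ

  -- Absorbing the core costs `2 * d` once; the rounds then start at `radius` instead of `d`.
  coreSpan : (b : ℕ → ℕ) → (∀ r → Returns G r (b r)) → Span G (_≡ p) (2 * d + total b radius)
  coreSpan b ret = extend G (_≟ᶠ p) (byKey-antisym key) (2 * d) (span G b ret radius core? near)

-- From spans to strong orientations.

-- No edge has both ends in a single vertex, so the span controls every edge; walks are routed
-- through `s`.
orient : (G : Graph n) {s : Fin n} {ρ : ℕ} → Span G (_≡ s) ρ → Σ (Orientation G) λ O → DiamLe (Arc O) (2 * ρ)
orient G {s} {ρ} (o , o-anti , link) = O , diam
  where
  O : Orientation G
  O .arc u v = adj G u v ∧ o u v
  O .arc⊆edge u v eq with adj G u v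
  ... | true = refl
  O .oneDir u v e with o u v in eq | o-anti v u (edge-≢ G (edge-sym G e))
  ... | true | eq′ rewrite e | edge-sym G e | eq′ = inj₁ (refl , refl)
  ... | false | eq′ rewrite e | edge-sym G e | eq′ = inj₂ (refl , refl)
  arcs : ∀ {u v} → OutArc G (_≡ s) o u v → Arc O u v
  arcs (e , t , _) rewrite e | t = refl
  diam : DiamLe (Arc O) (2 * ρ)
  diam u v with proj₂ (link u) | proj₁ (link v)
  ... | k , k≤ , _ , refl , α | l , l≤ , _ , refl , ζ =
    k + l , ≤-trans (+-mono-≤ k≤ l≤) (≤-reflexive (cong (ρ +_) (≡-sym (+-identityʳ ρ)))) , mapʷ arcs (α ++ʷ ζ)

total-const : ∀ c r → total (const c) r ≡ r * c
total-const c zero = refl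
total-const c (suc r) = cong (c +_) (total-const c r)

total-double : ∀ r → total (2 *_) r ≡ r * suc r
total-double zero = refl
total-double (suc r) = trans (cong (2 * suc r +_) (total-double r)) (eq r)
  where
  eq : ∀ r → 2 * suc r + r * suc r ≡ suc r * suc (suc r)
  eq = solve 1 (λ r → con 2 :* (con 1 :+ r) :+ r :* (con 1 :+ r) := (con 1 :+ r) :* (con 2 :+ r)) refl

theorem4 : (d : ℕ) → 1 ≤ d → (n : ℕ) → (G : Graph n) → TwoEdgeConnected G → HasDiameter (Edge G) d →
    Σ (Orientation G) λ O → Σ ℕ λ D → (1000 * D + 1000 ≤ 1373 * (d * d) + 6971 * d) × DiamLe (Arc O) D
theorem4 d 1≤d n G (_ , bridgeless) (diam , s , _) =
  cases (any? λ p → any? λ q → edge? G p q ×-dec ¬? (short? p q))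
  where
  t : ℕ
  t = threshold d

  -- Together with `uv`, such a detour is a closed walk of length at most `4 * t + 1`.
  Short : Rel₀ n
  Short u v = ∃[ k ] (k < suc (4 * t) × Walk (EdgeMinus G u v) u v k)

  short? : Dec₂ Short
  short? u v = anyUpTo? (λ k → walk? (edgeMinus? G u v) k u v) (suc (4 * t))

  Goal : Set
  Goal = Σ (Orientation G) λ O → Σ ℕ λ D → (1000 * D + 1000 ≤ 1373 * (d * d) + 6971 * d) × DiamLe (Arc O) D

  conclude : ∀ ρ {x} → 1000 * (2 * ρ) + 1000 ≤ 1373 * (d * d) + 6971 * d → Span G (_≡ x) ρ → Goal
  conclude ρ bound sp = proj₁ (orient G sp) , 2 * ρ , bound , proj₂ (orient G sp)

  cases : Dec (∃[ p ] ∃[ q ] (Edge G p q × ¬ Short p q)) → Goal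
  cases (yes (p , q , pq , long)) =
    conclude (2 * d + radius * suc radius) (long-bound d t radius 1≤d radius-eq (threshold-upper d))
      (subst (λ m → Span G (_≡ p) (2 * d + m)) (total-double radius) (coreSpan (2 *_) returns))
    where
    open LongCycle G diam pq (bridgeless p q pq) t (λ k≤ ω → long (_ , s≤s k≤ , ω))
    returns : ∀ r → Returns G r (2 * r)
    returns r u v e with bridgeless u v e u v
    ... | k , ω = k , ω , m⊓n≤n k (2 * r)
  cases (no none) =
    -- There are `d` rounds of cost `4 * t`; the starting vertex `s` is an end of the pair at
    -- distance `d`.
    conclude (d * (4 * t)) (short-bound d t 1≤d (threshold-lower d))
      (subst (Span G (_≡ s)) (total-const (4 * t) d) (span G (const (4 * t)) returns d (_≟ᶠ s) λ v →
        proj₁ (diam v s) , proj₁ (proj₂ (diam v s)) , s , refl , proj₂ (proj₂ (diam v s))))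
    where
    returns : ∀ r → Returns G r (4 * t)
    returns r u v e with decidable-stable (short? u v) (λ ¬short → none (u , v , e , ¬short))
    ... | k , s≤s k≤ , ω = k , ω , ≤-trans (m⊓n≤m k (2 * r)) k≤
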